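{- Suppose that $E_c\subseteq E_o$. Let $\mathcal{K}\subseteq\mathcal{L}$ be a fuzzy language over $E$. If $\mathcal{K}$ is controllable (with respect to $\mathcal{L}$ and $E_{uc}$) and observable (with respect to $\mathcal{L}$, $P$, and $E_c$), then $\mathcal{K}$ is normal (with respect to $\mathcal{L}$ and $P$).
   Context: $E$ is a finite set of events and $E^*$ is the set of all finite strings over $E$, including the empty string $\epsilon$. On $[0,1]$, $\wedge$ denotes infimum (minimum) and $\vee$ supremum. A fuzzy subset of a set $X$ is a function $X\to[0,1]$; $\mathcal{F}(X)$ is the set of all of them; $\mathcal{A}\subseteq\mathcal{B}$ means $\mathcal{A}(x)\le\mathcal{B}(x)$ for all $x$; $\mathrm{supp}(\mathcal{A})=\{x:\mathcal{A}(x)>0\}$; $(\mathcal{A}\cap\mathcal{B})(x)=\mathcal{A}(x)\wedge\mathcal{B}(x)$. A fuzzy language over $E$ is an $\mathcal{A}\in\mathcal{F}(E^*)$ which is either the empty fuzzy language $\mathcal{O}$ (identically $0$), or satisfies $\mathcal{A}(\epsilon)=1$ and $\mathcal{A}(\mu)\ge\mathcal{A}(\mu\nu)$ for all $\mu,\nu\in E^*$. $\mathcal{L}$ is a fixed fuzzy language over $E$ (the behavior of the uncontrolled system). The event set is partitioned as $E=E_c\,\dot\cup\,E_{uc}$ (controllable, uncontrollable) and as $E=E_o\,\dot\cup\,E_{uo}$ (observable, unobservable). The natural projection $P:E^*\to E_o^*$ erases unobservable events: $P(\epsilon)=\epsilon$, $P(sa)=P(s)P(a)$, where $P(a)=a$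 if $a\in E_o$ and $P(a)=\epsilon$ if $a\in E_{uo}$. Define $\mathcal{P}:\mathcal{F}(E^*)\to\mathcal{F}(E_o^*)$ by $\mathcal{P}(\mathcal{K})(\omega)=\vee_{P(\omega')=\omega}\mathcal{K}(\omega')$ and $\mathcal{P}^{ -1}:\mathcal{F}(E_o^*)\to\mathcal{F}(E^*)$ by $\mathcal{P}^{ -1}(\mathcal{M})(\omega)=\mathcal{M}(P(\omega))$. A fuzzy language $\mathcal{K}\subseteq\mathcal{L}$ is controllable (with respect to $\mathcal{L}$ and $E_{uc}$) if $\mathcal{K}(sa)=\mathcal{K}(s)\wedge\mathcal{L}(sa)$ for all $s\in E^*$ and $a\in E_{uc}$. It is observable (with respect to $\mathcal{L}$, $P$, and $E_c$) if for all $s,s'\in\mathrm{supp}(\mathcal{K})$ with $P(s)=P(s')$ and all $a\in E_c$ with $sa\in\mathrm{supp}(\mathcal{K})$, there is some $x\in[0,1]$ with $\mathcal{K}(sa)=\mathcal{K}(s)\wedge\mathcal{L}(sa)\wedge x$ such that $\mathcal{K}(s'a)=\mathcal{K}(s')\wedge\mathcal{L}(s'a)\wedge x$. It is normal (with respect to $\mathcal{L}$ and $P$) if $\mathcal{K}=\mathcal{P}^{ -1}[\mathcal{P}(\mathcal{K})]\cap\mathcal{L}$. -}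

module Defs where

open import Level using (0ℓ)
open import Data.Irrelevant using ([_])
open import Data.Fin.Base using (Fin)
open import Data.List.Base using (List; []; _∷_; _++_; _∷ʳ_; concatMap)
open import Data.List.Properties using (concatMap-++; ++-identityʳ)
open import Data.Product.Base using (_×_; _,_; ∃-syntax; proj₁; proj₂)
open import Data.Rational.Base as ℚ using (ℚ; 0ℚ; 1ℚ)
import Data.Rational.Properties as ℚ
open import Data.Refinement.Base as Refinement using (Refinement-syntax)
open import Data.Sum.Base using (_⊎_; inj₁; inj₂)
open import Function.Base using (_∘_)
open import Function.Bundles using (_↔_)
open import Relation.Binary.Core using (Rel)
open import Relation.Binary.Definitions using (tri<; tri≈; tri>)
open import Relation.Binary.Lattice.Definitions using (Infimum)
open import Relation.Binary.PropositionalEquality.Core using (_≡_; refl; cong; trans)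
open import Relation.Nullary.Decidable.Core using (yes; no)
open import Relation.Unary using (Pred; Decidable; _∈_; _∉_; _∪_; _∩_) renaming (_⊆_ to _⊆ᵖ_)

-- A real number r ∈ [0,1] is given by its lower Dedekind cut
-- { q ∈ ℚ ∣ q < r }.  Classically these cuts are exactly the elements of
-- [0,1].  Only the lower half of the cut is recorded because one-sided
-- cuts are constructively closed under arbitrary suprema, whereas
-- two-sided cuts are not.

record 𝕀 : Set₁ where
  field
    below       : Pred ℚ 0ℓ
    nonnegative : ∀ {q} → q ℚ.< 0ℚ → q ∈ below
    bounded     : ∀ {q} → q ∈ below → q ℚ.< 1ℚ
    down-closed : ∀ {p q} → p ℚ.< q → q ∈ below → p ∈ below
    rounded     : ∀ {p} → p ∈ below → ∃[ q ] p ℚ.< q × q ∈ below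

open 𝕀 public

infix 4 _≤_ _<_ _≈_

_≤_ : Rel 𝕀 0ℓ
x ≤ y = below x ⊆ᵖ below y

_≈_ : Rel 𝕀 0ℓ
x ≈ y = x ≤ y × y ≤ x

-- Some rational q satisfies x ≤ q < y.
_<_ : Rel 𝕀 0ℓ
x < y = ∃[ q ] q ∉ below x × q ∈ below y

fromℚ : (r : ℚ) → 0ℚ ℚ.≤ r → r ℚ.≤ 1ℚ → 𝕀
fromℚ r 0≤r r≤1 = record
  { below       = ℚ._< r
  ; nonnegative = λ q<0 → ℚ.<-≤-trans q<0 0≤r
  ; bounded     = λ q<r → ℚ.<-≤-trans q<r r≤1
  ; down-closed = ℚ.<-trans
  ; rounded     = λ p<r → let q , p<q , q<r = ℚ.<-dense p<r in q , p<q , q<r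
  }

private
  0≤1 : 0ℚ ℚ.≤ 1ℚ
  0≤1 = ℚ.nonNegative⁻¹ 1ℚ

0# 1# : 𝕀
0# = fromℚ 0ℚ ℚ.≤-refl 0≤1
1# = fromℚ 1ℚ 0≤1 ℚ.≤-refl

infixr 7 _∧_

_∧_ : 𝕀 → 𝕀 → 𝕀
x ∧ y = record
  { below       = below x ∩ below y
  ; nonnegative = λ q<0 → nonnegative x q<0 , nonnegative y q<0
  ; bounded     = λ (q∈x , _) → bounded x q∈x
  ; down-closed = λ p<q (q∈x , q∈y) → down-closed x p<q q∈x , down-closed y p<q q∈y
  ; rounded     = λ (p∈x , p∈y) → meet (rounded x p∈x) (rounded y p∈y)
  }
  where
  meet : ∀ {p} → (∃[ q ] p ℚ.< q × q ∈ below x) → (∃[ q ] p ℚ.< q × q ∈ below y) →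
         ∃[ q ] p ℚ.< q × q ∈ below x ∩ below y
  meet (q , p<q , q∈x) (r , p<r , r∈y) with ℚ.<-cmp q r
  ... | tri< q<r _ _    = q , p<q , q∈x , down-closed y q<r r∈y
  ... | tri≈ _ refl _   = q , p<q , q∈x , r∈y
  ... | tri> _ _ r<q    = r , p<r , down-closed x r<q q∈x , r∈y

∧-infimum : Infimum _≤_ _∧_
∧-infimum x y = proj₁ , proj₂ , λ z z≤x z≤y q∈z → z≤x q∈z , z≤y q∈z

-- The negative rationals are included so that the empty supremum is 0.
⋁ : {I : Set} → (I → 𝕀) → 𝕀
⋁ {I} f = record
  { below       = (ℚ._< 0ℚ) ∪ (λ q → ∃[ i ] q ∈ below (f i))
  ; nonnegative = inj₁
  ; bounded     = λ where
      (inj₁ q<0)       → ℚ.<-≤-trans q<0 0≤1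
      (inj₂ (i , q∈f)) → bounded (f i) q∈f
  ; down-closed = λ where
      p<q (inj₁ q<0)       → inj₁ (ℚ.<-trans p<q q<0)
      p<q (inj₂ (i , q∈f)) → inj₂ (i , down-closed (f i) p<q q∈f)
  ; rounded     = λ where
      (inj₁ p<0)       → let q , p<q , q<0 = ℚ.<-dense p<0 in q , p<q , inj₁ q<0
      (inj₂ (i , p∈f)) → let q , p<q , q∈f = rounded (f i) p∈f in q , p<q , inj₂ (i , q∈f)
  }

⋁-upper : {I : Set} (f : I → 𝕀) → ∀ i → f i ≤ ⋁ f
⋁-upper f i q∈f = inj₂ (i , q∈f)

⋁-least : {I : Set} (f : I → 𝕀) (z : 𝕀) → (∀ i → f i ≤ z) → ⋁ f ≤ z
⋁-least f z f≤z (inj₁ q<0)       = nonnegative z q<0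
⋁-least f z f≤z (inj₂ (i , q∈f)) = f≤z i q∈f

𝓕 : Set → Set₁
𝓕 X = X → 𝕀

module _ {X : Set} where

  infix 4 _⊆_ _≐_
  infixr 7 _∩ᶠ_

  _⊆_ _≐_ : 𝓕 X → 𝓕 X → Set
  A ⊆ B = ∀ x → A x ≤ B x
  A ≐ B = ∀ x → A x ≈ B x

  _∩ᶠ_ : 𝓕 X → 𝓕 X → 𝓕 X
  (A ∩ᶠ B) x = A x ∧ B x

  supp : 𝓕 X → Pred X 0ℓ
  supp A x = 0# < A x

  𝓞 : 𝓕 X
  𝓞 _ = 0#

Finite : Set → Set
Finite E = ∃[ n ] (E ↔ Fin n)

infix 8 _*

_* : Set → Set
E * = List E

IsFuzzyLanguage : {E : Set} → 𝓕 (E *) → Set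
IsFuzzyLanguage A = A ≐ 𝓞 ⊎ (A [] ≈ 1# × (∀ μ ν → A (μ ++ ν) ≤ A μ))

-- The events satisfying Eo, as a type; membership proofs are irrelevant,
-- so that two elements are equal as soon as the underlying events are.
Sub : {E : Set} → Pred E 0ℓ → Set
Sub {E} Eo = [ e ∈ E ∣ Eo e ]

module Projection {E : Set} {Eo : Pred E 0ℓ} (Eo? : Decidable Eo) where

  Pₑ : E → Sub Eo *
  Pₑ a with Eo? a
  ... | yes a∈Eo = (a Refinement., [ a∈Eo ]) ∷ []
  ... | no  _    = []

  P : E * → Sub Eo *
  P = concatMap Pₑ

  P-∷ʳ : ∀ s a → P (s ∷ʳ a) ≡ P s ++ Pₑ a
  P-∷ʳ s a = trans (concatMap-++ Pₑ s (a ∷ [])) (cong (P s ++_) (++-identityʳ (Pₑ a)))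

  𝓟 : 𝓕 (E *) → 𝓕 (Sub Eo *)
  𝓟 K ω = ⋁ {I = ∃[ ω′ ] P ω′ ≡ ω} (K ∘ proj₁)

  𝓟⁻¹ : 𝓕 (Sub Eo *) → 𝓕 (E *)
  𝓟⁻¹ M ω = M (P ω)

module _ {E : Set} where

  Controllable : (L : 𝓕 (E *)) (Euc : Pred E 0ℓ) → 𝓕 (E *) → Set
  Controllable L Euc K =
    ∀ s a → a ∈ Euc → K (s ∷ʳ a) ≈ K s ∧ L (s ∷ʳ a)

  Observable : (L : 𝓕 (E *)) {Eo : Pred E 0ℓ} (Eo? : Decidable Eo) (Ec : Pred E 0ℓ) →
               𝓕 (E *) → Set₁
  Observable L Eo? Ec K =
    ∀ s s′ → s ∈ supp K → s′ ∈ supp K → P s ≡ P s′ →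
    ∀ a → a ∈ Ec → s ∷ʳ a ∈ supp K →
    ∃[ x ] K (s ∷ʳ a) ≈ K s ∧ L (s ∷ʳ a) ∧ x × K (s′ ∷ʳ a) ≈ K s′ ∧ L (s′ ∷ʳ a) ∧ x
    where open Projection Eo?

  Normal : (L : 𝓕 (E *)) {Eo : Pred E 0ℓ} (Eo? : Decidable Eo) → 𝓕 (E *) → Set
  Normal L Eo? K = K ≐ 𝓟⁻¹ (𝓟 K) ∩ᶠ L
    where open Projection Eo?

-- 𝓟⁻¹(𝓟 K) ∩ L ⊆ K says that K ω ≥ K t ∧ L ω whenever P t ≡ P ω.  This goes by
-- induction on ω and t from their last events: unobservable events at the end
-- of ω are uncontrollable, so controllability appends them; those at the end
-- of t are dropped by prefix-closure; and a common last observable event is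
-- appended by observability or controllability, as it is controllable or not.
-- Comparing cuts at a single rational q ≥ 0 makes every string that occurs lie
-- in the support of K.

{-# OPTIONS --safe #-}
module Submission where

open import Defs
open import Level using (0ℓ)
open import Data.Empty using (⊥-elim)
open import Data.Irrelevant using ([_])
open import Data.List.Base using ([]; _∷_; _++_; _∷ʳ_)
open import Data.List.Properties using (++-identityʳ; ++-conicalʳ; ∷ʳ-injective)
open import Data.List.Reverse using (Reverse; []; _∶_∶ʳ_; reverseView)
open import Data.Product.Base using (_,_; proj₁; proj₂)
open import Data.Rational.Base as ℚ using (ℚ; 0ℚ)
import Data.Rational.Properties as ℚ
open import Data.Refinement.Base as Refinement using (value)
open import Data.Sum.Base using (inj₁; inj₂)
open import Function.Base using (_∘_; case_of_)
open import Relation.Binary.PropositionalEquality using (_≡_; refl; sym; trans; cong)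
open import Relation.Nullary using (¬_; yes; no)
open import Relation.Unary using (Pred; Decidable; ∁; _∈_) renaming (_⊆_ to _⊆ᵖ_)

-- For `𝓞`, every rational in the cut of a value is negative, hence in every cut.
prefix-≥ : {E : Set} (A : 𝓕 (E *)) → IsFuzzyLanguage A → ∀ μ ν → A (μ ++ ν) ≤ A μ
prefix-≥ A (inj₁ A≐𝓞)         μ ν q∈A = nonnegative (A μ) (proj₁ (A≐𝓞 (μ ++ ν)) q∈A)
prefix-≥ A (inj₂ (_ , closed)) μ ν     = closed μ ν

module _ {E : Set} {Eo : Pred E 0ℓ} (Eo? : Decidable Eo) where
  open Projection Eo?

  P-unobservable : ∀ s {a} → ¬ Eo a → P (s ∷ʳ a) ≡ P s
  P-unobservable s {a} a∉Eo with Eo? a | P-∷ʳ s a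
  ... | yes a∈Eo | _  = ⊥-elim (a∉Eo a∈Eo)
  ... | no  _    | eq = trans eq (++-identityʳ (P s))

  P-observable : ∀ s {a} (a∈Eo : Eo a) → P (s ∷ʳ a) ≡ P s ∷ʳ (a Refinement., [ a∈Eo ])
  P-observable s {a} a∈Eo with Eo? a | P-∷ʳ s a
  ... | yes _   | eq = eq
  ... | no a∉Eo | _  = ⊥-elim (a∉Eo a∈Eo)

  module _ {Ec : Pred E 0ℓ} (Ec? : Decidable Ec) (Ec⊆Eo : Ec ⊆ᵖ Eo)
           (L K : 𝓕 (E *)) (L-lang : IsFuzzyLanguage L) (K-lang : IsFuzzyLanguage K)
           (controllable : Controllable L (∁ Ec) K) (observable : Observable L Eo? Ec K)
           {q : ℚ} (q≮0 : ¬ q ℚ.< 0ℚ) where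

    append-same-observation :
      ∀ s t a → P s ≡ P t → q ∈ below (K s) → q ∈ below (K (t ∷ʳ a)) →
      q ∈ below (L (s ∷ʳ a)) → q ∈ below (K (s ∷ʳ a))
    append-same-observation s t a Ps≡Pt q∈Ks q∈Kta q∈Lsa with Ec? a
    ... | no a∉Ec  = proj₂ (controllable s a a∉Ec) (q∈Ks , q∈Lsa)
    ... | yes a∈Ec =
      let q∈Kt = prefix-≥ K K-lang t (a ∷ []) q∈Kta
          -- `t` takes the role of the first string, since `t ∷ʳ a` is the continuation known to lie
          -- in the support. The resulting `x` has `q` in its cut because `K (t ∷ʳ a) ≤ x`.
          _ , Kta≈ , Ksa≈ = observable t s (q , q≮0 , q∈Kt) (q , q≮0 , q∈Ks)
                              (sym Ps≡Pt) a a∈Ec (q , q≮0 , q∈Kta)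
          _ , _ , q∈x = proj₁ Kta≈ q∈Kta
      in proj₂ Ksa≈ (q∈Ks , q∈Lsa , q∈x)

    -- Each recursive call removes the last event of `s`, of `t` or of both, so the `Reverse` views
    -- drive the recursion.
    transfer : ∀ {s t} → Reverse s → Reverse t → P s ≡ P t →
               q ∈ below (K t) → q ∈ below (L s) → q ∈ below (K s)
    transfer {t = t} [] _ _ q∈Kt _ = prefix-≥ K K-lang [] t q∈Kt
    transfer (s ∶ rs ∶ʳ a) rt Psa≡Pt q∈Kt q∈Lsa with Eo? a
    ... | no a∉Eo = proj₂ (controllable s a (a∉Eo ∘ Ec⊆Eo))
      ( transfer rs rt (trans (sym (P-unobservable s a∉Eo)) Psa≡Pt) q∈Kt
          (prefix-≥ L L-lang s (a ∷ []) q∈Lsa)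
      , q∈Lsa)
    -- The projection of `s ∷ʳ a` ends in `a`, so it cannot be empty.
    transfer (s ∶ rs ∶ʳ a) [] Psa≡[] _ _ | yes a∈Eo =
      case ++-conicalʳ (P s) _ (trans (sym (P-observable s a∈Eo)) Psa≡[]) of λ ()
    transfer (s ∶ rs ∶ʳ a) (t ∶ rt ∶ʳ b) Psa≡Ptb q∈Ktb q∈Lsa | yes a∈Eo with Eo? b
    ... | no b∉Eo = transfer (s ∶ rs ∶ʳ a) rt (trans Psa≡Ptb (P-unobservable t b∉Eo))
                      (prefix-≥ K K-lang t (b ∷ []) q∈Ktb) q∈Lsa
    ... | yes b∈Eo
      with Ps≡Pt , ã≡b̃ ← ∷ʳ-injective (P s) (P t)
             (trans (sym (P-observable s a∈Eo)) (trans Psa≡Ptb (P-observable t b∈Eo)))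
      -- Equal last observations come from the same event: `b` becomes `a`.
      with refl ← cong value ã≡b̃
      = append-same-observation s t a Ps≡Pt
          (transfer rs rt Ps≡Pt (prefix-≥ K K-lang t (a ∷ []) q∈Ktb)
            (prefix-≥ L L-lang s (a ∷ []) q∈Lsa))
          q∈Ktb q∈Lsa

theorem4 : {E : Set} → Finite E →
    {Ec Eo : Pred E 0ℓ} → Decidable Ec → (Eo? : Decidable Eo) →
    (L : 𝓕 (E *)) → IsFuzzyLanguage L →
    Ec ⊆ᵖ Eo →
    (K : 𝓕 (E *)) → IsFuzzyLanguage K → K ⊆ L →
    Controllable L (∁ Ec) K →
    Observable L Eo? Ec K →
    Normal L Eo? K
theorem4 _ Ec? Eo? L L-lang Ec⊆Eo K K-lang K⊆L controllable observable ω =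
  -- `ω` is itself one of the strings over which the supremum at `P ω` runs.
  (λ q∈Kω → inj₂ ((ω , refl) , q∈Kω) , K⊆L ω q∈Kω) , 𝓟⁻¹𝓟K∩L≤K
  where
  open Projection Eo?

  𝓟⁻¹𝓟K∩L≤K : (𝓟⁻¹ (𝓟 K) ∩ᶠ L) ω ≤ K ω
  𝓟⁻¹𝓟K∩L≤K     (inj₁ q<0 , _) = nonnegative (K ω) q<0
  𝓟⁻¹𝓟K∩L≤K {q} (inj₂ ((t , Pt≡Pω) , q∈Kt) , q∈Lω) with q ℚ.<? 0ℚ
  -- A negative `q` lies in every cut; only `q ≥ 0` can witness membership in the support, as
  -- `transfer` requires.
  ... | yes q<0 = nonnegative (K ω) q<0
  ... | no q≮0  = transfer Eo? Ec? Ec⊆Eo L K L-lang K-lang controllable observable q≮0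
                    (reverseView ω) (reverseView t) (sym Pt≡Pω) q∈Kt q∈Lω
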